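{- For every $m\ge 2$, the generalized wheel graph $W_{m,3}=\overline{K}_m+C_3$ satisfies $\operatorname{nim}(\mathrm{DNT}(W_{m,3}))=1$ and $\operatorname{nim}(\mathrm{TER}(W_{m,3}))=2$.
   Context: The generalized wheel graph $W_{m,n}$ ($m\ge 2$, $n\ge 3$) is the join $\overline{K}_m+C_n$ of the edgeless graph on $m$ vertices and the cycle graph on $n$ vertices, i.e. their disjoint union together with all edges between the two vertex sets ($C_3=K_3$). For a graph $G$ with vertex set $V$, a set $K\subseteq V$ is convex if it contains every vertex lying on any shortest path between two elements of $K$. The convex hull $[P]$ of $P\subseteq V$ is the smallest convex set containing $P$. The game $\mathrm{DNT}(G)$: positions are the sets $P\subseteq V$ with $[V\setminus P]=V$; the starting position is $\emptyset$; the options of $P$ are the sets $P\cup\{v\}$ with $v\in V\setminus P$ and $[V\setminus(P\cup\{v\})]=V$. The game $\mathrm{TER}(G)$: positions are the sets $P\subseteq V$ reachable from the starting position $\emptyset$ by the following moves. If $[V\setminus P]=V$, then the options of $P$ are all sets $P\cup\{v\}$ with $v\in V\setminus P$; if $[V\setminus P]\neq V$, then $P$ is terminal (has no options). The nim-value of a position is defined recursively by $\operatorname{nim}(p)=\operatorname{mex}\{\operatorname{nim}(q): q\text{ an option of }p\}$, where $\operatorname{mex}(A)$ is the smallest nonnegative integer not in $A$; the nim-value of a game is that of its starting position. -}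

module Defs where

open import Data.Empty using () renaming (⊥ to Empty)
open import Data.Fin.Base using (Fin; toℕ; splitAt)
open import Data.Fin.Subset using (Subset; _∈_; _∉_; _⊆_; _∪_; ⁅_⁆; ∁; ⊤; ⊥; _⊃_)
open import Data.Fin.Subset.Induction using (⊃-wellFounded)
open import Data.Fin.Subset.Properties
  using (p⊆p∪q; q⊆p∪q; x∈⁅x⁆; ∈⊤; ⊆⊤; ∉⊥; x∉p⇒x∈∁p)
open import Data.List.Base using (List; head; last; length)
import Data.List.Membership.Propositional as List
open import Data.List.Relation.Unary.Linked using (Linked)
open import Data.List.Relation.Unary.Unique.Propositional using (Unique)
open import Data.Maybe.Base using (just)
open import Data.Nat.Base using (ℕ; zero; suc; _+_; _≤_; _<_; s≤s)
open import Data.Nat.Properties using (<-cmp; m≢1+n+m)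
open import Data.Product.Base using (Σ; ∃; _×_; _,_; proj₁; proj₂)
open import Data.Sum.Base using (_⊎_; inj₁; inj₂; swap)
open import Data.Unit.Base using (tt) renaming (⊤ to Unit)
open import Function.Base using (flip; _on_)
open import Function.Bundles using (_⇔_; mk⇔)
open import Induction.WellFounded using (Acc; acc; WellFounded; module Subrelation)
open import Level using (0ℓ)
open import Relation.Binary.Construct.Closure.ReflexiveTransitive using (Star; ε)
import Relation.Binary.Construct.On as On
open import Relation.Binary.Core using (Rel)
open import Relation.Binary.Definitions using (Symmetric; tri<; tri≈; tri>)
open import Relation.Binary.PropositionalEquality using (_≡_; refl; sym; trans; cong)
open import Relation.Nullary.Negation using (¬_; contradiction)
open import Relation.Unary using (Pred)

------------------------------------------------------------------------
-- Finite simple graphs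

record Graph (n : ℕ) : Set₁ where
  field
    Adj       : Rel (Fin n) 0ℓ
    symmetric : Symmetric Adj
    loopless  : ∀ {u} → ¬ Adj u u

edgeless : (n : ℕ) → Graph n
edgeless n = record
  { Adj       = λ _ _ → Empty
  ; symmetric = λ ()
  ; loopless  = λ ()
  }

-- The cyclic successor relation on 0, …, n - 1.
data _follows_ {n : ℕ} (j i : Fin n) : Set where
  step : toℕ j ≡ suc (toℕ i)           → j follows i
  wrap : suc (toℕ i) ≡ n → toℕ j ≡ 0 → j follows i

cycle : (n : ℕ) → 3 ≤ n → Graph n
cycle n 3≤n = record
  { Adj       = λ i j → j follows i ⊎ i follows j
  ; symmetric = swap
  ; loopless  = λ { (inj₁ e) → irrefl 3≤n e ; (inj₂ e) → irrefl 3≤n e }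
  }
  where
  irrefl : ∀ {n} → 3 ≤ n → {i : Fin n} → ¬ (i follows i)
  irrefl _ {i} (step i≡1+i) = m≢1+n+m (toℕ i) {0} i≡1+i
  irrefl 3≤n (wrap 1+i≡n i≡0) with trans (sym 1+i≡n) (cong suc i≡0)
  irrefl (s≤s ()) (wrap _ _) | refl

-- The vertices of the join are those of G (the first m) followed by those
-- of H.
module _ {m n : ℕ} (G : Graph m) (H : Graph n) where
  private
    module G = Graph G
    module H = Graph H

  Adj⊎ : Rel (Fin m ⊎ Fin n) 0ℓ
  Adj⊎ (inj₁ u) (inj₁ v) = G.Adj u v
  Adj⊎ (inj₂ u) (inj₂ v) = H.Adj u v
  Adj⊎ (inj₁ _) (inj₂ _) = Unit
  Adj⊎ (inj₂ _) (inj₁ _) = Unit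

  sym⊎ : ∀ x y → Adj⊎ x y → Adj⊎ y x
  sym⊎ (inj₁ _) (inj₁ _) e = G.symmetric e
  sym⊎ (inj₂ _) (inj₂ _) e = H.symmetric e
  sym⊎ (inj₁ _) (inj₂ _) _ = tt
  sym⊎ (inj₂ _) (inj₁ _) _ = tt

  loopless⊎ : ∀ x → ¬ Adj⊎ x x
  loopless⊎ (inj₁ _) = G.loopless
  loopless⊎ (inj₂ _) = H.loopless

  join : Graph (m + n)
  join = record
    { Adj       = Adj⊎ on splitAt m
    ; symmetric = λ {u} {v} → sym⊎ (splitAt m u) (splitAt m v)
    ; loopless  = λ {u} → loopless⊎ (splitAt m u)
    }

W : (m n : ℕ) → 2 ≤ m → 3 ≤ n → Graph (m + n)
W m n _ 3≤n = join (edgeless m) (cycle n 3≤n)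

------------------------------------------------------------------------
-- Geodesic convexity

module _ {n : ℕ} (G : Graph n) where
  open Graph G

  record IsPath (u v : Fin n) (p : List (Fin n)) : Set where
    field
      starts   : head p ≡ just u
      ends     : last p ≡ just v
      linked   : Linked Adj p
      distinct : Unique p

  -- Lengths are compared by the number of vertices.
  IsShortestPath : (u v : Fin n) → List (Fin n) → Set
  IsShortestPath u v p =
    IsPath u v p × (∀ q → IsPath u v q → length p ≤ length q)

  Convex : Subset n → Set
  Convex K = ∀ {u v w p} → u ∈ K → v ∈ K →
             IsShortestPath u v p → w List.∈ p → w ∈ K

  record IsHull (P H : Subset n) : Set where
    field
      convex   : Convex H
      contains : P ⊆ H
      smallest : ∀ K → Convex K → P ⊆ K → H ⊆ K

  -- [ S ] = V
  Generating : Subset n → Set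
  Generating S = IsHull S ⊤

------------------------------------------------------------------------
-- Impartial games and nim-values

record Game : Set₁ where
  infix 4 _⟶_
  field
    Position    : Set
    start       : Position
    _⟶_         : Rel Position 0ℓ    -- p ⟶ q: q is an option of p
    wellFounded : WellFounded (flip _⟶_)

IsMex : Pred ℕ 0ℓ → ℕ → Set
IsMex A n = ¬ A n × (∀ k → k < n → A k)

-- Options are given by a relation that need not be decidable, so the
-- nim-value is a relation between positions and numbers, defined by
-- recursion along the options: HasNim p k says nim(p) = k.  Its defining
-- equation is HasNim⇔mex, and HasNim-unique shows that it is functional.
module _ (G : Game) where
  open Game G

  HasNimAcc : ∀ {p} → Acc (flip _⟶_) p → Pred ℕ 0ℓ
  HasNimAcc {p} (acc rs) =
    IsMex λ k → ∃ λ q → Σ (p ⟶ q) λ p⟶q → HasNimAcc (rs p⟶q) k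

  HasNim : Position → Pred ℕ 0ℓ
  HasNim p = HasNimAcc (wellFounded p)

  private
    irrelevant : ∀ {p k} (a b : Acc (flip _⟶_) p) →
                 HasNimAcc a k → HasNimAcc b k
    irrelevant (acc rs) (acc ss) (k∉ , <k∈) =
      (λ { (q , o , h) → k∉ (q , o , irrelevant (ss o) (rs o) h) }) ,
      (λ j j<k → let (q , o , h) = <k∈ j j<k in
                 q , o , irrelevant (rs o) (ss o) h)

    unfold : ∀ {p k} (a : Acc (flip _⟶_) p) → HasNimAcc a k →
             IsMex (λ j → ∃ λ q → p ⟶ q × HasNim q j) k
    unfold (acc rs) (k∉ , <k∈) =
      (λ { (q , o , h) → k∉ (q , o , irrelevant (wellFounded q) (rs o) h) }) ,
      (λ j j<k → let (q , o , h) = <k∈ j j<k in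
                 q , o , irrelevant (rs o) (wellFounded q) h)

    fold : ∀ {p k} (a : Acc (flip _⟶_) p) →
           IsMex (λ j → ∃ λ q → p ⟶ q × HasNim q j) k → HasNimAcc a k
    fold (acc rs) (k∉ , <k∈) =
      (λ { (q , o , h) → k∉ (q , o , irrelevant (rs o) (wellFounded q) h) }) ,
      (λ j j<k → let (q , o , h) = <k∈ j j<k in
                 q , o , irrelevant (wellFounded q) (rs o) h)

  HasNim⇔mex : ∀ {p k} →
               HasNim p k ⇔ IsMex (λ j → ∃ λ q → p ⟶ q × HasNim q j) k
  HasNim⇔mex {p} = mk⇔ (unfold (wellFounded p)) (fold (wellFounded p))

  HasNim-unique : ∀ {p j k} → HasNim p j → HasNim p k → j ≡ k
  HasNim-unique {p} {j} {k} hj hk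
    with unfold (wellFounded p) hj | unfold (wellFounded p) hk | <-cmp j k
  ... | j∉ , _   | _  , <k∈ | tri< j<k _ _ = contradiction (<k∈ j j<k) j∉
  ... | _        | _        | tri≈ _ j≡k _ = j≡k
  ... | _  , <j∈ | k∉ , _   | tri> _ _ k<j = contradiction (<j∈ k k<j) k∉

  Nim : Pred ℕ 0ℓ
  Nim = HasNim start

------------------------------------------------------------------------
-- The games DNT and TER

data _adds-vertex-to_ {n : ℕ} (Q P : Subset n) : Set where
  adds : ∀ v → v ∉ P → Q ≡ P ∪ ⁅ v ⁆ → Q adds-vertex-to P

adds⇒⊃ : ∀ {n} {P Q : Subset n} → Q adds-vertex-to P → Q ⊃ P
adds⇒⊃ {P = P} (adds v v∉P refl) =
  p⊆p∪q ⁅ v ⁆ , v , q⊆p∪q P ⁅ v ⁆ (x∈⁅x⁆ v) , v∉P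

module _ {n : ℕ} (G : Graph n) where

  ∁⊥-generating : Generating G (∁ ⊥)
  ∁⊥-generating = record
    { convex   = λ _ _ _ _ → ∈⊤
    ; contains = ⊆⊤
    ; smallest = λ _ _ ∁⊥⊆K _ → ∁⊥⊆K (x∉p⇒x∈∁p ∉⊥)
    }

  DNT : Game
  DNT = record
    { Position    = ∃ λ P → Generating G (∁ P)
    ; start       = ⊥ , ∁⊥-generating
    ; _⟶_         = λ P Q → proj₁ Q adds-vertex-to proj₁ P
    ; wellFounded = Subrelation.wellFounded adds⇒⊃
                      (On.wellFounded proj₁ ⊃-wellFounded)
    }

  TERMove : Rel (Subset n) 0ℓ
  TERMove P Q = Generating G (∁ P) × Q adds-vertex-to P

  TER : Game
  TER = record
    { Position    = ∃ λ P → Star TERMove ⊥ P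
    ; start       = ⊥ , ε
    ; _⟶_         = λ P Q → TERMove (proj₁ P) (proj₁ Q)
    ; wellFounded = Subrelation.wellFounded (λ move → adds⇒⊃ (proj₂ move))
                      (On.wellFounded proj₁ ⊃-wellFounded)
    }

{-# OPTIONS --safe #-}
-- Since the cycle C₃ is complete, each of the m independent vertices is
-- simplicial, hence an interior vertex of no shortest path, so every
-- generating set contains all of them; conversely two of them already have
-- all of C₃ in their hull.  So V ∖ P generates exactly when P lies in C₃, and
-- both nim-values depend only on the number k of vertices of C₃ left: for
-- k > 0 every option in DNT has k - 1 of them left, while in TER removing an
-- independent vertex is a further option, of value 0.

module Submission where

open import Defs
open import Data.Fin.Base using (Fin; splitAt)
open import Data.Fin.Patterns using (0F; 1F; 2F)
open import Data.Fin.Properties using (_≟_; splitAt⁻¹-↑ʳ)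
open import Data.Fin.Subset
open import Data.Fin.Subset.Properties
open import Data.List.Base using ([]; _∷_; last; length)
open import Data.List.Membership.Propositional using () renaming (_∈_ to _∈ˡ_)
open import Data.List.Relation.Binary.Sublist.Propositional
  using (_∷_; _∷ʳ_) renaming (_⊆_ to Sublist; ⊆-refl to Sublist-refl)
open import Data.List.Relation.Binary.Sublist.Propositional.Properties
  using (All-resp-⊆)
open import Data.List.Relation.Unary.All using ([]; _∷_)
open import Data.List.Relation.Unary.AllPairs using ([]; _∷_)
open import Data.List.Relation.Unary.Any using (here; there)
open import Data.List.Relation.Unary.Linked using (Linked; [-]; _∷_)
open import Data.List.Relation.Unary.Unique.Propositional using (Unique)
open import Data.Maybe.Base using (just)
open import Data.Nat.Base using (ℕ; zero; suc; _+_; _≤_; _<_; z≤n; s≤s)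
open import Data.Nat.Properties using (≤-refl; <⇒≱; suc-injective; 0≢1+n)
open import Data.Product.Base using (∃; _×_; _,_; proj₁; proj₂)
open import Data.Sum.Base using (_⊎_; inj₁; inj₂; [_,_]′)
open import Data.Unit.Base using (tt)
open import Data.Vec.Base using (_∷_; _++_; here; there)
open import Data.Vec.Properties
  using (lookup-splitAt; lookup-replicate; []=⇒lookup; lookup⇒[]=)
open import Function.Base using (_∘_)
open import Function.Bundles using (_⇔_; mk⇔; Equivalence)
open import Level using (0ℓ)
open import Relation.Binary.Construct.Closure.ReflexiveTransitive
  using (ε; _◅_; _◅◅_)
open import Relation.Binary.PropositionalEquality
open import Relation.Nullary using (yes; no; ¬_; contradiction)
open import Relation.Nullary.Decidable using (decidable-stable)
open import Relation.Unary using (Pred)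

open Equivalence

-- Simplicial vertices and shortest paths

module _ {n : ℕ} (G : Graph n) where
  open Graph G

  Simplicial : Fin n → Set
  Simplicial v = ∀ {a b} → Adj a v → Adj v b → a ≢ b → Adj a b

  -- Cut `v` out of the path: its two neighbours there are distinct because the path repeats no
  -- vertex, hence adjacent because `v` is simplicial. The sublist component serves the induction:
  -- it keeps the head distinct from the vertices of the shortened tail.
  bypass : ∀ {v} → Simplicial v → ∀ {x y xs} → x ≢ v → y ≢ v →
           Linked Adj (x ∷ xs) → Unique (x ∷ xs) →
           last (x ∷ xs) ≡ just y → v ∈ˡ x ∷ xs →
           ∃ λ ys → Linked Adj (x ∷ ys) × Unique (x ∷ ys) ×
             last (x ∷ ys) ≡ just y × length ys < length xs × Sublist ys xs
  bypass simp x≢v y≢v l u e (here v≡x) = contradiction (sym v≡x) x≢v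
  bypass {v} simp {x} {y} {w ∷ ws} x≢v y≢v (xw ∷ l) u e (there v∈)
    with w ≟ v
  bypass {v} simp {x} {y} {w ∷ []} x≢v y≢v (xw ∷ l) u refl (there v∈)
    | yes w≡v = contradiction w≡v y≢v
  bypass {v} simp {x} {y} {w ∷ z ∷ zs} x≢v y≢v
    (xw ∷ wz ∷ l) ((_ ∷ x≢z ∷ x∉zs) ∷ _ ∷ u) e (there v∈)
    | yes refl = z ∷ zs , simp xw wz x≢z ∷ l , (x≢z ∷ x∉zs) ∷ u , e ,
                 ≤-refl , w ∷ʳ Sublist-refl
  bypass {v} simp {x} {y} {w ∷ ws} x≢v y≢v (xw ∷ l) ((x≢w ∷ x∉) ∷ u) e
    (there v∈) | no w≢v =
    let ys , l′ , u′ , e′ , ys<ws , ys⊆ws = bypass simp w≢v y≢v l u e v∈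
    in  w ∷ ys , xw ∷ l′ , (x≢w ∷ All-resp-⊆ ys⊆ws x∉) ∷ u′ , e′ ,
        s≤s ys<ws , refl ∷ ys⊆ws

  ∁-simplicial-convex : ∀ {v} → Simplicial v → Convex G (∁ ⁅ v ⁆)
  ∁-simplicial-convex {v} simp {a} {b} {w} {p} a∈ b∈ (path , shortest) w∈p =
    x∉p⇒x∈∁p λ w∈⁅v⁆ →
      avoids p path shortest (subst (_∈ˡ p) (x∈⁅y⁆⇒x≡y v w∈⁅v⁆) w∈p)
    where
    ≢v : ∀ {x} → x ∈ ∁ ⁅ v ⁆ → x ≢ v
    ≢v x∈ refl = x∈∁p⇒x∉p x∈ (x∈⁅x⁆ v)

    avoids : ∀ p → IsPath G a b p →
             (∀ q → IsPath G a b q → length p ≤ length q) → ¬ v ∈ˡ p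
    avoids (x ∷ xs)
      record { starts = refl ; ends = e ; linked = l ; distinct = u }
      shortest v∈
      with bypass simp (≢v a∈) (≢v b∈) l u e v∈
    ... | ys , l′ , u′ , e′ , ys<xs , _ =
      <⇒≱ (s≤s ys<xs) (shortest (x ∷ ys)
        record { starts = refl ; ends = e′ ; linked = l′ ; distinct = u′ })

  -- Puts every common neighbour of two nonadjacent vertices into their hull. A path with one or two
  -- vertices would make `a` and `b` equal or adjacent.
  common-neighbour-shortest : ∀ {a b w} → a ≢ b → ¬ Adj a b →
    Adj a w → Adj w b → IsShortestPath G a b (a ∷ w ∷ b ∷ [])
  common-neighbour-shortest {a} {b} {w} a≢b ¬ab aw wb =
    record
      { starts   = refl
      ; ends     = refl
      ; linked   = aw ∷ wb ∷ [-]
      ; distinct = (adj⇒≢ aw ∷ a≢b ∷ []) ∷ (adj⇒≢ wb ∷ []) ∷ [] ∷ []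
      } , longer
    where
    adj⇒≢ : ∀ {x y} → Adj x y → x ≢ y
    adj⇒≢ xy refl = loopless xy

    longer : ∀ q → IsPath G a b q → 3 ≤ length q
    longer (_ ∷ []) record { starts = refl ; ends = refl } =
      contradiction refl a≢b
    longer (_ ∷ _ ∷ [])
      record { starts = refl ; ends = refl ; linked = ab ∷ _ } =
      contradiction ab ¬ab
    longer (_ ∷ _ ∷ _ ∷ _) _ = s≤s (s≤s (s≤s z≤n))

-- Cardinalities of finite subsets

x∈p⇒∣p∣≡1+∣p-x∣ : ∀ {n} {p : Subset n} {x} → x ∈ p → ∣ p ∣ ≡ suc ∣ p - x ∣
x∈p⇒∣p∣≡1+∣p-x∣ {p = inside ∷ p} here = cong (suc ∘ ∣_∣) (sym (p─⊥≡p p))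
x∈p⇒∣p∣≡1+∣p-x∣ {p = inside  ∷ p} (there x∈p) = cong suc (x∈p⇒∣p∣≡1+∣p-x∣ x∈p)
x∈p⇒∣p∣≡1+∣p-x∣ {p = outside ∷ p} (there x∈p) = x∈p⇒∣p∣≡1+∣p-x∣ x∈p

∣p∣≡1+k⇒nonempty : ∀ {n k} {p : Subset n} → ∣ p ∣ ≡ suc k → Nonempty p
∣p∣≡1+k⇒nonempty {n} {p = p} ∣p∣≡1+k = decidable-stable (nonempty? p) λ empty →
  0≢1+n (trans (sym (trans (cong ∣_∣ (Empty-unique empty)) (∣⊥∣≡0 n))) ∣p∣≡1+k)

x∈p─q⇒x∉q : ∀ {n} (p q : Subset n) {x} → x ∈ p ─ q → x ∉ q
x∈p─q⇒x∉q (_ ∷ _) (inside ∷ _) () here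
x∈p─q⇒x∉q (_ ∷ p) (_ ∷ q) (there x∈p─q) (there x∈q) =
  x∈p─q⇒x∉q p q x∈p─q x∈q

∣⊥++p∣≡∣p∣ : ∀ m {n} (p : Subset n) → ∣ ⊥ {m} ++ p ∣ ≡ ∣ p ∣
∣⊥++p∣≡∣p∣ zero    p = refl
∣⊥++p∣≡∣p∣ (suc m) p = ∣⊥++p∣≡∣p∣ m p

-- Mex of sets with at most two elements

flip01 : ℕ → ℕ
flip01 zero    = 1
flip01 (suc _) = 0

-- Iterates the mex of a singleton, which is what `flip01` computes, so that the nim-value
-- inductions match its recursion definitionally.
parity : ℕ → ℕ
parity zero    = 0
parity (suc k) = flip01 (parity k)

mex-none : ∀ {A : Pred ℕ 0ℓ} → (∀ {j} → ¬ A j) → IsMex A 0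
mex-none ¬A = ¬A , λ _ ()

mex-singleton : ∀ {A : Pred ℕ 0ℓ} x → (∀ {j} → A j → j ≡ x) → A x →
                IsMex A (flip01 x)
mex-singleton zero    A⇒≡ Ax =
  (λ A1 → contradiction (A⇒≡ A1) λ ()) ,
  λ { zero _ → Ax ; (suc _) (s≤s ()) }
mex-singleton (suc x) A⇒≡ _ =
  (λ A0 → contradiction (A⇒≡ A0) λ ()) , λ _ ()

-- With 0 attained, the mex is one more than that of the other value lowered by one. This keeps the
-- values in TER one above those in DNT.
mex-0,1+ : ∀ {A : Pred ℕ 0ℓ} x → (∀ {j} → A j → j ≡ 0 ⊎ j ≡ suc x) →
           A 0 → A (suc x) → IsMex A (suc (flip01 x))
mex-0,1+ zero A⇒ A0 A1 =
  (λ A2 → [ (λ ()) , (λ ()) ]′ (A⇒ A2)) ,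
  λ { zero _ → A0 ; (suc zero) _ → A1 ; (suc (suc _)) (s≤s (s≤s ())) }
mex-0,1+ (suc x) A⇒ A0 _ =
  (λ A1 → [ (λ ()) , (λ ()) ]′ (A⇒ A1)) ,
  λ { zero _ → A0 ; (suc _) (s≤s ()) }

-- Nim-values when exactly the subsets of `R` have a generating complement

module _ {n : ℕ} (G : Graph n) (R : Subset n)
         (generating⇔⊆R : ∀ (P : Subset n) → Generating G (∁ P) ⇔ P ⊆ R) where

  private
    ∪⁅v⁆⊆R : ∀ (P : Subset n) {v} → P ⊆ R → v ∈ R → P ∪ ⁅ v ⁆ ⊆ R
    ∪⁅v⁆⊆R P {v} P⊆R v∈R x∈ with x∈p∪q⁻ P ⁅ v ⁆ x∈
    ... | inj₁ x∈P   = P⊆R x∈P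
    ... | inj₂ x∈⁅v⁆ = subst (_∈ R) (sym (x∈⁅y⁆⇒x≡y v x∈⁅v⁆)) v∈R

    v∈P∪⁅v⁆ : ∀ (P : Subset n) v → v ∈ P ∪ ⁅ v ⁆
    v∈P∪⁅v⁆ P v = q⊆p∪q P ⁅ v ⁆ (x∈⁅x⁆ v)

    remaining : ∀ P {v} → v ∈ R → v ∉ P → ∣ R ─ P ∣ ≡ suc ∣ R ─ (P ∪ ⁅ v ⁆) ∣
    remaining P {v} v∈R v∉P =
      trans (x∈p⇒∣p∣≡1+∣p-x∣ (x∈p∧x∉q⇒x∈p─q v∈R v∉P))
            (cong (suc ∘ ∣_∣) (p─q─r≡p─q∪r R P ⁅ v ⁆))

    remaining-step : ∀ P {v k} → v ∈ R → v ∉ P → ∣ R ─ P ∣ ≡ suc k →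
                     ∣ R ─ (P ∪ ⁅ v ⁆) ∣ ≡ k
    remaining-step P v∈R v∉P eq =
      suc-injective (trans (sym (remaining P v∈R v∉P)) eq)

    none-remaining : ∀ P {v} → v ∈ R → v ∉ P → ¬ ∣ R ─ P ∣ ≡ 0
    none-remaining P v∈R v∉P eq with trans (sym eq) (remaining P v∈R v∉P)
    ... | ()

  -- Every option stays inside `R`, so it lowers `∣ R ─ P ∣` by one. By induction all options share
  -- one value, and an option exists as long as a vertex of `R` is left.
  nim-DNT-position : ∀ k P g → ∣ R ─ P ∣ ≡ k → HasNim (DNT G) (P , g) (parity k)
  nim-DNT-position zero P g eq = from (HasNim⇔mex (DNT G) {P , g}) (mex-none λ
    { ((_ , g′) , adds v v∉P refl , _) →
      none-remaining P (to (generating⇔⊆R _) g′ (v∈P∪⁅v⁆ P v)) v∉P eq })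
  nim-DNT-position (suc k) P g eq = from (HasNim⇔mex (DNT G) {P , g})
    (mex-singleton (parity k)
      -- The option comes with an arbitrary value `j`; uniqueness identifies it with the inductive
      -- one.
      (λ { (Q@(_ , g′) , adds v v∉P refl , h) →
           HasNim-unique (DNT G) {Q} h (nim-DNT-position k _ g′
             (remaining-step P (to (generating⇔⊆R _) g′ (v∈P∪⁅v⁆ P v)) v∉P eq)) })
      (let v , v∈R─P = ∣p∣≡1+k⇒nonempty eq
           v∈R       = p─q⊆p R P v∈R─P
           v∉P       = x∈p─q⇒x∉q R P v∈R─P
           g′        = from (generating⇔⊆R _) (∪⁅v⁆⊆R P (to (generating⇔⊆R P) g) v∈R)
       in  (_ , g′) , adds v v∉P refl ,
           nim-DNT-position k _ g′ (remaining-step P v∈R v∉P eq)))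

  nim-DNT : Nim (DNT G) (parity ∣ R ∣)
  nim-DNT = nim-DNT-position ∣ R ∣ ⊥ (∁⊥-generating G) (cong ∣_∣ (p─⊥≡p R))

  nim-TER-terminal : ∀ P s → ¬ P ⊆ R → HasNim (TER G) (P , s) 0
  nim-TER-terminal P s P⊈R = from (HasNim⇔mex (TER G) {P , s}) (mex-none λ
    { (_ , (g , _) , _) → P⊈R (to (generating⇔⊆R P) g) })

  module _ {e : Fin n} (e∉R : e ∉ R) where

    private
      -- While `P ⊆ R`, the vertex `e` is still free, and taking it ends the game.
      leave : ∀ P s → P ⊆ R →
              ∃ λ Q → TERMove G P (proj₁ Q) × HasNim (TER G) Q 0
      leave P s P⊆R =
        (_ , s ◅◅ move ◅ ε) , move ,
        nim-TER-terminal (P ∪ ⁅ e ⁆) (s ◅◅ move ◅ ε) λ Q⊆R → e∉R (Q⊆R (v∈P∪⁅v⁆ P e))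
        where
        move : TERMove G P (P ∪ ⁅ e ⁆)
        move = from (generating⇔⊆R P) P⊆R , adds e (e∉R ∘ P⊆R) refl

    -- Taking a vertex of `R` leaves one fewer and is covered by induction; taking any other vertex
    -- ends the game with value 0.
    nim-TER-position : ∀ k P s → P ⊆ R → ∣ R ─ P ∣ ≡ k →
                       HasNim (TER G) (P , s) (suc (parity k))
    nim-TER-position zero P s P⊆R eq = from (HasNim⇔mex (TER G) {P , s})
      -- With `R` exhausted every option is terminal, so the mex is `flip01 0`, that is
      -- `suc (parity zero)`.
      (mex-singleton 0
        (λ { (Q@(_ , s′) , (_ , adds v v∉P refl) , h) →
             HasNim-unique (TER G) {Q} h (nim-TER-terminal _ s′
               λ Q⊆R → none-remaining P (Q⊆R (v∈P∪⁅v⁆ P v)) v∉P eq) })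
        (leave P s P⊆R))
    nim-TER-position (suc k) P s P⊆R eq = from (HasNim⇔mex (TER G) {P , s})
      (mex-0,1+ (parity k) options (leave P s P⊆R)
        (let v , v∈R─P = ∣p∣≡1+k⇒nonempty eq
             v∈R       = p─q⊆p R P v∈R─P
             v∉P       = x∈p─q⇒x∉q R P v∈R─P
             move      = from (generating⇔⊆R P) P⊆R , adds v v∉P refl
         in  (_ , s ◅◅ move ◅ ε) , move ,
             nim-TER-position k _ (s ◅◅ move ◅ ε) (∪⁅v⁆⊆R P P⊆R v∈R)
               (remaining-step P v∈R v∉P eq)))
      where
      options : ∀ {j} →
        (∃ λ Q → TERMove G P (proj₁ Q) × HasNim (TER G) Q j) →
        j ≡ 0 ⊎ j ≡ suc (parity k)
      options (Q@(_ , s′) , (_ , adds v v∉P refl) , h) with v ∈? R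
      ... | yes v∈R = inj₂ (HasNim-unique (TER G) {Q} h
              (nim-TER-position k _ s′ (∪⁅v⁆⊆R P P⊆R v∈R)
                (remaining-step P v∈R v∉P eq)))
      ... | no v∉R = inj₁ (HasNim-unique (TER G) {Q} h
              (nim-TER-terminal _ s′ λ Q⊆R → v∉R (Q⊆R (v∈P∪⁅v⁆ P v))))

    nim-TER : Nim (TER G) (suc (parity ∣ R ∣))
    nim-TER = nim-TER-position ∣ R ∣ ⊥ ε (λ x∈⊥ → contradiction x∈⊥ ∉⊥)
                (cong ∣_∣ (p─⊥≡p R))

-- Generating sets in the join of an edgeless and a complete graph

right : ∀ m {n} → Subset (m + n)
right m = ⊥ {m} ++ ⊤

module _ {m n : ℕ} {v : Fin (m + n)} where

  inj₁⇒∉right : ∀ {i} → splitAt m v ≡ inj₁ i → v ∉ right m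
  inj₁⇒∉right {i} eq v∈ with trans (sym ([]=⇒lookup v∈))
    (trans (lookup-splitAt m (⊥ {m}) (⊤ {n}) v)
      (trans (cong [ _ , _ ]′ eq) (lookup-replicate i outside)))
  ... | ()

  inj₂⇒∈right : ∀ {i} → splitAt m v ≡ inj₂ i → v ∈ right m
  inj₂⇒∈right {i} eq = lookup⇒[]= v _
    (trans (lookup-splitAt m (⊥ {m}) (⊤ {n}) v)
      (trans (cong [ _ , _ ]′ eq) (lookup-replicate i inside)))

module _ {n : ℕ} (H : Graph n)
         (complete : ∀ {i j} → i ≢ j → Graph.Adj H i j) where

  -- Left vertices are pairwise nonadjacent, so both neighbours lie in `H`, which is complete.
  left-simplicial : ∀ m {v} → v ∉ right m → Simplicial (join (edgeless m) H) v
  left-simplicial m {v} v∉ {a} {b} av vb a≢b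
    with splitAt m v in v≡ | splitAt m a in a≡ | splitAt m b in b≡
  ... | inj₂ _ | _      | _      = contradiction (inj₂⇒∈right v≡) v∉
  ... | inj₁ _ | inj₁ _ | _      = contradiction av λ ()
  ... | inj₁ _ | inj₂ _ | inj₁ _ = contradiction vb λ ()
  ... | inj₁ _ | inj₂ _ | inj₂ _ = complete λ { refl →
    a≢b (trans (sym (splitAt⁻¹-↑ʳ a≡)) (splitAt⁻¹-↑ʳ b≡)) }

  -- If `P` had a left vertex `x`, the convex set `∁ ⁅ x ⁆` would contain `∁ P`. Conversely, if `P`
  -- has none, two left vertices survive in `∁ P`, and every vertex of `H` is a common neighbour of
  -- theirs.
  join-generating : ∀ m → 2 ≤ m → ∀ P →
                    Generating (join (edgeless m) H) (∁ P) ⇔ P ⊆ right m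
  join-generating m@(suc (suc _)) (s≤s (s≤s _)) P = mk⇔ generating⇒⊆ ⊆⇒generating
    where
    G = join (edgeless m) H

    generating⇒⊆ : Generating G (∁ P) → P ⊆ right m
    generating⇒⊆ hull {x} x∈P = decidable-stable (x ∈? right m) λ x∉ →
      x∈∁p⇒x∉p
        (IsHull.smallest hull (∁ ⁅ x ⁆)
          (∁-simplicial-convex G (left-simplicial m x∉))
          (λ {y} y∈∁P → x∉p⇒x∈∁p λ y∈⁅x⁆ →
            x∈∁p⇒x∉p y∈∁P (subst (_∈ P) (sym (x∈⁅y⁆⇒x≡y x y∈⁅x⁆)) x∈P))
          ∈⊤)
        (x∈⁅x⁆ x)

    ⊆⇒generating : P ⊆ right m → Generating G (∁ P)
    ⊆⇒generating P⊆ = record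
      { convex   = λ _ _ _ _ → ∈⊤
      ; contains = ⊆⊤
      ; smallest = λ K convex ∁P⊆K {w} _ → spans K convex ∁P⊆K w
      }
      where
      spans : ∀ K → Convex G K → ∁ P ⊆ K → ∀ w → w ∈ K
      spans K convex ∁P⊆K w with splitAt m w in w≡
      ... | inj₁ _ = ∁P⊆K (x∉p⇒x∈∁p (inj₁⇒∉right w≡ ∘ P⊆))
      ... | inj₂ _ = convex {u = 0F} {v = 1F}
        (∁P⊆K (x∉p⇒x∈∁p (inj₁⇒∉right {m} {v = 0F} refl ∘ P⊆)))
        (∁P⊆K (x∉p⇒x∈∁p (inj₁⇒∉right {m} {v = 1F} refl ∘ P⊆)))
        (common-neighbour-shortest G {0F} {1F} {w} (λ ()) (λ ())
          -- Adjacency of `w` to `0F` and `1F` reduces to `Unit` only once `splitAt m w` is known to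
          -- be an `inj₂`.
          (subst (Adj⊎ (edgeless m) H (inj₁ 0F)) (sym w≡) tt)
          (subst (λ x → Adj⊎ (edgeless m) H x (inj₁ 1F)) (sym w≡) tt))
        (there (here refl))

-- The triangle and the two nim-values

cycle₃-complete : ∀ {i j} → i ≢ j → Graph.Adj (cycle 3 ≤-refl) i j
cycle₃-complete {0F} {0F} i≢j = contradiction refl i≢j
cycle₃-complete {0F} {1F} _   = inj₁ (step refl)
cycle₃-complete {0F} {2F} _   = inj₂ (wrap refl refl)
cycle₃-complete {1F} {0F} _   = inj₂ (step refl)
cycle₃-complete {1F} {1F} i≢j = contradiction refl i≢j
cycle₃-complete {1F} {2F} _   = inj₁ (step refl)
cycle₃-complete {2F} {0F} _   = inj₁ (wrap refl refl)
cycle₃-complete {2F} {1F} _   = inj₂ (step refl)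
cycle₃-complete {2F} {2F} i≢j = contradiction refl i≢j

proposition5p30 : (m : ℕ) (2≤m : 2 ≤ m) →
    Nim (DNT (W m 3 2≤m ≤-refl)) 1 × Nim (TER (W m 3 2≤m ≤-refl)) 2
proposition5p30 m@(suc (suc _)) 2≤m@(s≤s (s≤s _)) =
  -- `R` is the triangle, so the values are `parity 3`, which is 1, and its successor.
  subst (Nim (DNT G)) (cong parity ∣R∣≡3) (nim-DNT G R generating) ,
  subst (Nim (TER G)) (cong (suc ∘ parity) ∣R∣≡3)
    -- The independent vertex `0F` serves as the game-ending vertex `e`.
    (nim-TER G R generating {0F} (inj₁⇒∉right {m} {v = 0F} refl))
  where
  G = W m 3 2≤m ≤-refl
  R = right m

  generating : ∀ P → Generating G (∁ P) ⇔ P ⊆ R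
  generating = join-generating (cycle 3 ≤-refl) cycle₃-complete m 2≤m

  ∣R∣≡3 : ∣ R ∣ ≡ 3
  ∣R∣≡3 = ∣⊥++p∣≡∣p∣ m ⊤
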